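{- Let $\mathbb{S}$ be a normal modal system, let $\mathcal{S}$ be the set of specific axiom schemata for $\mathbb{S}$, and let $\mathfrak{S}$ be the characteristic class of frames for $\mathbb{S}$. For every modal formula $A$, if $\mathcal{S}\vdash A$ then $\mathfrak{S}\vDash A$.
   Context: Syntax. Modal formulas are generated from a countably infinite set $\Phi$ of propositional atoms by $A ::= \bot \mid p \mid A\to B \mid \Box A$ ($p\in\Phi$). Abbreviations: $\top:=\bot\to\bot$, $\neg A:=A\to\bot$, $A\lor B:=\neg A\to B$, $A\land B:=\neg(\neg A\lor\neg B)$, $\Diamond A:=\neg\Box\neg A$. Semantics. A frame is a pair $\langle W,R\rangle$ with $W$ a nonempty set and $R\subseteq W\times W$. A model based on it is $\mathcal{M}=\langle W,R,V\rangle$ with $V\subseteq\Phi\times W$. Forcing: $\mathcal{M},w\vDash p$ iff $pVw$; $\mathcal{M},w\not\vDash\bot$; $\mathcal{M},w\vDash B\to C$ iff $\mathcal{M},w\not\vDash B$ or $\mathcal{M},w\vDash C$; $\mathcal{M},w\vDash\Box B$ iff $\mathcal{M},x\vDash B$ for all $x\in W$ with $wRx$. $\langle W,R\rangle\vDash A$ (validity in a frame) means $\mathcal{M},w\vDash A$ for every model $\mathcal{M}$ based on $\langle W,R\rangle$ and every $w\in W$. For a class of frames $\mathfrak{S}$, $\mathfrak{S}\vDash A$ means $\mathcal{F}\vDash A$ for every $\mathcal{F}\in\mathfrak{S}$. Deducibility. The axioms of the minimal calculus $\mathsf{K}$ are all instances of a fixed complete set of schemata for classical propositional logic and of $\Box(A\to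 B)\to(\Box A\to\Box B)$. Let $\mathcal{S}$ be a set of axiom schemata (identified with the set of its instances). The relation $\mathcal{S}.\mathcal{H}\vdash A$ is inductively defined by: (i) $\mathcal{S}.\mathcal{H}\vdash A$ if $A$ is an axiom of $\mathsf{K}$; (ii) $\mathcal{S}.\mathcal{H}\vdash A$ if $A$ is an instance of a schema in $\mathcal{S}$; (iii) $\mathcal{S}.\mathcal{H}\vdash A$ if $A\in\mathcal{H}$; (iv) if $\mathcal{S}.\mathcal{H}\vdash B\to A$ and $\mathcal{S}.\mathcal{H}\vdash B$ then $\mathcal{S}.\mathcal{H}\vdash A$; (v) if $\mathcal{S}.\varnothing\vdash A$ then $\mathcal{S}.\mathcal{H}\vdash\Box A$ for any $\mathcal{H}$. Write $\mathcal{S}\vdash A$ for $\mathcal{S}.\varnothing\vdash A$. The normal modal system $\mathbb{S}$ with specific schemata $\mathcal{S}$ is the logic whose theorems are the $A$ with $\mathcal{S}\vdash A$. The characteristic class of frames for $\mathbb{S}$ is the class of exactly those frames in which every (instance of every) axiom schema in $\mathcal{S}$ is valid. -}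

module Defs where

open import Level using (Level; _⊔_; 0ℓ) renaming (suc to lsuc)
open import Data.Nat.Base using (ℕ)
open import Data.Empty.Polymorphic using (⊥)
open import Data.Product.Base using (∃-syntax; _×_)
open import Data.Sum.Base using (_⊎_)
open import Relation.Binary.Core using (Rel)
open import Relation.Binary.PropositionalEquality.Core using (_≡_)
open import Relation.Nullary.Negation.Core using (¬_)
open import Relation.Unary using (Pred; _∈_; ∅)

private variable
  s h ℓ c : Level

Atom : Set
Atom = ℕ

infixr 20 _⇒_
infix  30 □_ ∼_ ◇_
infixr 25 _∨_ _∧_

data Formula : Set where
  ⊥′   : Formula
  atom : Atom → Formula
  _⇒_  : Formula → Formula → Formula
  □_   : Formula → Formula

⊤′ : Formula
⊤′ = ⊥′ ⇒ ⊥′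

∼_ ◇_ : Formula → Formula
∼ A = A ⇒ ⊥′
◇ A = ∼ □ ∼ A

_∨_ _∧_ : Formula → Formula → Formula
A ∨ B = ∼ A ⇒ B
A ∧ B = ∼ (∼ A ∨ ∼ B)

-- A schema is written as a formula whose atoms play the role of
-- metavariables; its instances are its simultaneous substitution instances.

Schema : Set
Schema = Formula

infixl 40 _[_]

_[_] : Schema → (Atom → Formula) → Formula
⊥′      [ σ ] = ⊥′
atom p  [ σ ] = σ p
(A ⇒ B) [ σ ] = A [ σ ] ⇒ B [ σ ]
(□ A)   [ σ ] = □ (A [ σ ])

Instance : Pred Schema s → Pred Formula s
Instance 𝒮 A = ∃[ X ] (X ∈ 𝒮 × ∃[ σ ] A ≡ X [ σ ])

-- With modus ponens, the first three schemata are complete for classical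
-- propositional logic over ⊥′ and _⇒_.

data KAxiom : Pred Formula 0ℓ where
  weakening  : ∀ A B → KAxiom (A ⇒ B ⇒ A)
  distrib-⇒  : ∀ A B C → KAxiom ((A ⇒ B ⇒ C) ⇒ (A ⇒ B) ⇒ A ⇒ C)
  double-neg : ∀ A → KAxiom (∼ ∼ A ⇒ A)
  distrib-□  : ∀ A B → KAxiom (□ (A ⇒ B) ⇒ □ A ⇒ □ B)

infix 4 _∙_⊢_ _⊢_

data _∙_⊢_ {s h} (𝒮 : Pred Schema s) (ℋ : Pred Formula h) :
           Formula → Set (s ⊔ h) where
  axiomK : ∀ {A} → A ∈ KAxiom → 𝒮 ∙ ℋ ⊢ A
  axiomS : ∀ {A} → A ∈ Instance 𝒮 → 𝒮 ∙ ℋ ⊢ A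
  hyp    : ∀ {A} → A ∈ ℋ → 𝒮 ∙ ℋ ⊢ A
  mp     : ∀ {A B} → 𝒮 ∙ ℋ ⊢ B ⇒ A → 𝒮 ∙ ℋ ⊢ B → 𝒮 ∙ ℋ ⊢ A
  nec    : ∀ {A} → 𝒮 ∙ ∅ ⊢ A → 𝒮 ∙ ℋ ⊢ □ A

_⊢_ : Pred Schema s → Formula → Set s
𝒮 ⊢ A = 𝒮 ∙ ∅ ⊢ A

record Frame ℓ : Set (lsuc ℓ) where
  field
    W     : Set ℓ
    R     : Rel W ℓ
    point : W   -- nonemptiness

record Model (F : Frame ℓ) : Set (lsuc ℓ) where
  open Frame F
  field
    V : Atom → Pred W ℓ

infix 4 _,_⊨_ _⊨ᶠ_ _⊨ᶜ_

-- Implication is the classical disjunctive clause rather than the function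
-- space, so even A ⇒ A is forced everywhere only under excluded middle.

_,_⊨_ : {F : Frame ℓ} → Model F → Frame.W F → Formula → Set ℓ
M , w ⊨ ⊥′     = ⊥
M , w ⊨ atom p = Model.V M p w
M , w ⊨ B ⇒ C  = ¬ (M , w ⊨ B) ⊎ (M , w ⊨ C)
_,_⊨_ {F = F} M w (□ B) = ∀ x → Frame.R F w x → M , x ⊨ B

_⊨ᶠ_ : Frame ℓ → Formula → Set (lsuc ℓ)
F ⊨ᶠ A = (M : Model F) (w : Frame.W F) → M , w ⊨ A

_⊨ᶜ_ : Pred (Frame ℓ) c → Formula → Set (lsuc ℓ ⊔ c)
𝔖 ⊨ᶜ A = ∀ F → F ∈ 𝔖 → F ⊨ᶠ A

Characteristic : Pred Schema s → Pred (Frame ℓ) (s ⊔ lsuc ℓ)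
Characteristic 𝒮 F = ∀ A → A ∈ Instance 𝒮 → F ⊨ᶠ A

module Submission where

open import Level using (Level)
open import Data.Empty.Polymorphic using (⊥-elim)
open import Data.Sum.Base using (_⊎_; inj₁; inj₂; map₁; swap; [_,_]′)
open import Function.Base using (id)
open import Relation.Nullary.Decidable.Core using (toSum)
open import Relation.Nullary.Negation.Core using (¬_; contradiction)
open import Relation.Unary using (Pred; _∈_)
open import Axiom.ExcludedMiddle using (ExcludedMiddle)
open import Defs

-- Fix a frame in the characteristic class and induct on the derivation. The induction claim is
-- validity in the frame, not truth at one world, so it passes under `□`. Specific axioms are valid
-- by choice of the frame, axioms of K by `KAxiom-valid`, and modus ponens acts world by world.

private variable
  ℓ : Level
  P Q : Set ℓ

material⇒→ : ¬ P ⊎ Q → P → Q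
material⇒→ (inj₁ ¬p) p = contradiction p ¬p
material⇒→ (inj₂ q)  _ = q

-- Decide `P`: if it holds, apply `f`; otherwise its refutation is the left disjunct.
→⇒material : ExcludedMiddle ℓ → {P Q : Set ℓ} → (P → Q) → ¬ P ⊎ Q
→⇒material em f = swap (map₁ f (toSum em))

KAxiom-valid : ExcludedMiddle ℓ → (F : Frame ℓ) → ∀ {A} → A ∈ KAxiom → F ⊨ᶠ A
KAxiom-valid {ℓ} em F = valid
  where
  intro : {P Q : Set ℓ} → (P → Q) → ¬ P ⊎ Q
  intro = →⇒material em

  valid : ∀ {A} → A ∈ KAxiom → F ⊨ᶠ A
  valid (weakening A B) M w = intro λ a → intro λ _ → a
  valid (distrib-⇒ A B C) M w = intro λ abc → intro λ ab → intro λ a →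
    material⇒→ (material⇒→ abc a) (material⇒→ ab a)
  -- If `A` fails at `w`, then `inj₁ ¬a` forces `∼ A` there, which contradicts `¬¬a`.
  valid (double-neg A) M w = intro λ ¬¬a →
    [ id , (λ ¬a → ⊥-elim (material⇒→ ¬¬a (inj₁ ¬a))) ]′ (toSum em)
  valid (distrib-□ A B) M w = intro λ □ab → intro λ □a x wRx →
    material⇒→ (□ab x wRx) (□a x wRx)

theorem1p7p1 : ∀ {s ℓ : Level} → ExcludedMiddle ℓ →
    (𝒮 : Pred Schema s) (A : Formula) →
    𝒮 ⊢ A → Characteristic {s} {ℓ} 𝒮 ⊨ᶜ A
-- The case `hyp` is vacuous, since no formula lies in `∅`.
theorem1p7p1 em 𝒮 A (axiomK k) F _ = KAxiom-valid em F k
theorem1p7p1 em 𝒮 A (axiomS i) F char = char A i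
theorem1p7p1 em 𝒮 A (mp {B = B} B⇒A ⊢B) F char M w =
  material⇒→ (theorem1p7p1 em 𝒮 (B ⇒ A) B⇒A F char M w)
             (theorem1p7p1 em 𝒮 B ⊢B F char M w)
-- The premise of `nec` is again derived from `∅`, so `A` is valid in `F` and holds at every world,
-- in particular at each successor `x` of `w`.
theorem1p7p1 em 𝒮 (□ A) (nec ⊢A) F char M w x _ =
  theorem1p7p1 em 𝒮 A ⊢A F char M x
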